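{- The following problems are decidable for one-dimensional stochastic cellular automata: (1) given $F$, is it noisy? (2) given $F$, is it surjective? (3) given $F$, is it injective? (4) given $F$, is it pre-injective? (5) given $F$ and $G$, do we have $\mathcal{N}_F^t=\mathcal{N}_G^t$? (where $t$ is any fixed positive integer) (6) given $F$, are there $u\in L$ and a configuration $c$ such that $\mathcal{N}_F(c)\subseteq[u]_0$? (where $L$ is any fixed rational language) (7) given $F$, are there $u\in L$ and a configuration $c$ such that $\mathcal{N}_F(c)\cap[u]_0\neq\varnothing$? (where $L$ is any fixed rational language)
   Context: A (one-dimensional) stochastic cellular automaton is a tuple $(Q,R,V,V',f)$ where $Q$ (states) and $R$ (random symbols) are finite sets, $V=\{v_1,\dots,v_\rho\}$ and $V'=\{v'_1,\dots,v'_{\rho'}\}$ are finite subsets of $\mathbb{Z}$, and $f:Q^\rho\times R^{\rho'}\to Q$. It is identified with its explicit global function $F:Q^{\mathbb{Z}}\times R^{\mathbb{Z}}\to Q^{\mathbb{Z}}$, $F(c,s)_z=f\big((c_{z+v_j})_j,(s_{z+v'_j})_j\big)$, and given as input by its finite description. Its non-deterministic global function is $\mathcal{N}_F(c)=\{F(c,s):s\in R^{\mathbb{Z}}\}$, with iterates $\mathcal{N}_F^0(c)=\{c\}$ and $\mathcal{N}_F^{t+1}(c)=\bigcup_{c'\in\mathcal{N}_F^t(c)}\mathcal{N}_F(c')$. $F$ is noisy if $\mathcal{N}_F(c)=Q^{\mathbb{Z}}$ for all $c\in Q^{\mathbb{Z}}$. $F$ is surjective if for any $c\in Q^{\mathbb{Z}}$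 there are $c'\in Q^{\mathbb{Z}}$, $s\in R^{\mathbb{Z}}$ with $F(c',s)=c$. $F$ is injective if for all $c_1,c_2\in Q^{\mathbb{Z}}$ and $s_1,s_2\in R^{\mathbb{Z}}$, $F(c_1,s_1)=F(c_2,s_2)\Rightarrow c_1=c_2$. $F$ is pre-injective if the same implication holds for all $s_1,s_2$ and all $c_1,c_2$ differing in only finitely many cells. A rational language is a regular language of finite words (here over the set of states). For a finite word $u=u_0\cdots u_{|u|-1}$, $[u]_0=\{c\in Q^{\mathbb{Z}}:c_x=u_x\text{ for all }0\le x<|u|\}$. -}

module Defs where

open import Axiom.ExcludedMiddle using (ExcludedMiddle)
open import Data.Bool.Base using (Bool)
open import Data.Fin.Base using (Fin; toℕ)
import Data.Fin.Properties as Fin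
open import Data.Integer.Base using (ℤ; +_; _+_)
open import Data.List.Base using (List; length; lookup)
open import Data.List.Membership.Propositional using () renaming (_∈_ to _∈ₗ_)
open import Data.Nat.Base using (ℕ; zero; suc)
open import Data.Product.Base using (Σ-syntax; ∃; ∃₂; ∃-syntax; _×_)
open import Data.Vec.Base using (Vec; map)
open import Data.Vec.Relation.Unary.Unique.Propositional using (Unique)
open import Level using (0ℓ) renaming (suc to lsuc)
open import Relation.Binary.PropositionalEquality using (_≡_; _≢_; _≗_)
open import Relation.Nullary.Reflects using (Reflects)
open import Relation.Unary using (Pred; _∈_; _≐_; U)
import Text.Regex.Base as Regex

-- Configurations are compared pointwise (_≗_) throughout, since function
-- extensionality is not available.
Config : ℕ → Set
Config q = ℤ → Fin q

-- The state set is Fin q.  V and V′ are finite subsets of ℤ, each given by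
-- an enumeration without repetition.
record SCA (q : ℕ) : Set where
  field
    r         : ℕ
    {ρ ρ′}    : ℕ
    V         : Vec ℤ ρ
    V-unique  : Unique V
    V′        : Vec ℤ ρ′
    V′-unique : Unique V′
    f         : Vec (Fin q) ρ → Vec (Fin r) ρ′ → Fin q

  global : Config q → Config r → Config q
  global c s z = f (map (λ v → c (z + v)) V) (map (λ v → s (z + v)) V′)

open SCA public using (r; global)

module _ {q : ℕ} where

  𝒩 : SCA q → Config q → Pred (Config q) 0ℓ
  𝒩 F c d = ∃[ s ] global F c s ≗ d

  𝒩^ : ℕ → SCA q → Config q → Pred (Config q) 0ℓ
  𝒩^ zero    F c d = c ≗ d
  𝒩^ (suc t) F c d = ∃[ c′ ] c′ ∈ 𝒩^ t F c × d ∈ 𝒩 F c′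

  Noisy : SCA q → Set
  Noisy F = ∀ c → 𝒩 F c ≐ U

  Surjective : SCA q → Set
  Surjective F = ∀ c → ∃₂ λ c′ s → global F c′ s ≗ c

  Injective : SCA q → Set
  Injective F = ∀ c₁ c₂ s₁ s₂ → global F c₁ s₁ ≗ global F c₂ s₂ → c₁ ≗ c₂

  DifferFinitely : Config q → Config q → Set
  DifferFinitely c₁ c₂ = Σ[ zs ∈ List ℤ ] (∀ z → c₁ z ≢ c₂ z → z ∈ₗ zs)

  PreInjective : SCA q → Set
  PreInjective F = ∀ c₁ c₂ s₁ s₂ → DifferFinitely c₁ c₂ →
    global F c₁ s₁ ≗ global F c₂ s₂ → c₁ ≗ c₂

  [_]₀ : List (Fin q) → Pred (Config q) 0ℓ
  [ u ]₀ c = ∀ (x : Fin (length u)) → c (+ toℕ x) ≡ lookup u x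

  -- The order on Fin q only serves to interpret the letter ranges of the
  -- library's regular expressions.
  open Regex (Fin.≤-preorder q) using (Exp) renaming (_∈_ to _matches_)

  Rational : Pred (List (Fin q)) 0ℓ → Set
  Rational L = Σ[ e ∈ Exp ] L ≐ (_matches e)

-- This splits Dec (P x) into its two halves.  The decision procedure is a
-- Boolean function built without any axiom, hence an algorithm.  Only its
-- correctness may use classical logic: the problems concern configurations on
-- all of ℤ, and their analysis rests on compactness, which is not constructive.
-- Excluded middle must stay inside the Σ: assumed before the choice of
-- decide, it would make every P decidable.
Decidable : {A : Set} → Pred A 0ℓ → Set (lsuc 0ℓ)
Decidable {A} P =
  Σ[ decide ∈ (A → Bool) ] (ExcludedMiddle 0ℓ → ∀ x → Reflects (P x) (decide x))

{-# OPTIONS --safe #-}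
module Submission where

-- All seven problems reduce to finite graphs.  A local map or constraint on
-- configurations over a finite alphabet C only inspects a window of 2k+1
-- cells, so the configurations satisfying it at every cell are the
-- bi-infinite paths of a finite graph whose vertices are windows
-- (at-read, at-path).  Three questions about such subshifts suffice.
--
-- * Injectivity and pre-injectivity (Subshift.marked?).  A failure is a pair
--   of configurations with equal images that differ at the origin, and
--   outside a bounded region only in the second problem do they have to
--   agree.  This asks for a bi-infinite path through a marked vertex whose
--   two ends eventually stay in a prescribed set.  By the pigeonhole
--   principle each end can be replaced by a lasso, a finite path leading to
--   a cycle in the prescribed set, and lassos are found by Warshall's
--   transitive closure.
--
-- * Noise, surjectivity and equality of iterates (Extension.extendable?).
--   Each says that every sequence over an alphabet A is the first track of
--   a point of a subshift over a product A × H, that is, labels a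
--   bi-infinite path of a finite graph.  By compactness this holds if and
--   only if every finite word labels a finite path, and the subset
--   construction turns that into a reachability question.  For the iterates
--   the first track carries an initial configuration together with t random
--   configurations for one automaton, and the second track carries t random
--   configurations for the other.  Excluded middle is only used in the
--   compactness argument.
--
-- * The problems about a rational language (Language.produces?).  Both the
--   inclusion of 𝒩 F c in a cylinder and its meeting one are local
--   conditions read along a word, for the inclusion because distinct
--   neighbours carry independent random symbols.  By induction on a regular
--   expression, the pairs of windows joined by a path that reads a word of
--   its language form a decidable relation, transitive closure accounting
--   for the star.

open import Defs
open import Axiom.ExcludedMiddle using (ExcludedMiddle)
open import Data.Bool.Base using (Bool; true; false; T)
open import Data.Bool.Properties using (T?)
open import Data.Fin.Base using (Fin; zero; suc; toℕ; combine; remQuot; inject₁)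
open import Data.Fin.Induction using (<-weakInduction)
import Data.Fin.Properties as Fin
open import Data.Integer.Base as ℤ using (ℤ; +_; -[1+_]; ∣_∣; 0ℤ; 1ℤ; _+_; _-_)
import Data.Integer.Properties as ℤ
open import Data.List.Base as List using (List; []; _∷_; length; lookup)
open import Data.List.Membership.Propositional using () renaming (_∈_ to _∈ₗ_)
open import Data.List.Membership.Propositional.Properties
  using (∈-tabulate⁺; ∈-++⁺ˡ; ∈-++⁺ʳ; ∈-map⁺; ∈-upTo⁺)
import Data.List.Relation.Ternary.Appending.Propositional as Appending
open import Data.List.Relation.Unary.Any using (here; there)
open import Data.Nat.Base as ℕ
  using (ℕ; NonZero; zero; suc; _≤_; _<_; _≤′_; ≤′-refl; ≤′-step; z≤n; s≤s)
open import Data.Nat.DivMod using (_mod_; m≤n⇒m%n≡m)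
import Data.Nat.Properties as ℕ
open import Data.Product.Base
  using (Σ; ∃; Σ-syntax; ∃-syntax; _×_; _,_; proj₁; proj₂; uncurry)
open import Data.Sum.Base using (_⊎_; inj₁; inj₂; [_,_]′)
open import Data.Unit.Base using (⊤; tt)
open import Data.Vec.Base as Vec using (Vec; []; _∷_; tabulate)
open import Data.Vec.Properties using (lookup∘tabulate; tabulate∘lookup; tabulate-cong; map-cong)
import Data.Vec.Relation.Unary.All as All
import Data.Vec.Relation.Unary.AllPairs.Core as AllPairs
open import Data.Vec.Relation.Unary.Unique.Propositional using (Unique)
open import Function.Base using (_∘_; flip; id)
open import Function.Bundles using (_⇔_; mk⇔)
open import Level using (0ℓ)
open import Relation.Binary.Bundles using (DecTotalOrder)
open import Relation.Binary.Construct.Closure.ReflexiveTransitive using (Star; ε; _◅_; _◅◅_)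
open import Relation.Binary.Core using (Rel)
import Relation.Binary.Definitions as B
open import Relation.Binary.PropositionalEquality
  using (_≡_; _≢_; _≗_; refl; sym; trans; cong; cong₂; subst)
open import Relation.Nullary
  using (¬_; Dec; yes; no; does; proof; _because_; contradiction; Reflects)
open import Relation.Nullary.Decidable as Dec
  using (map′; _×-dec_; _⊎-dec_; _→-dec_; ¬?; ⌊_⌋; decidable-stable; toWitness; fromWitness)
open import Relation.Unary using (Pred; _∈_; _⊆_; _∩_; _≐_; Satisfiable)
import Relation.Unary as U
import Text.Regex.Base as Regex
import Text.Regex.Properties as RegexProperties

-- Decisions whose correctness may rest on excluded middle

-- A Boolean that reflects P in the presence of excluded middle: the
-- pointwise form of Decidable.
Decision : Set → Set₁
Decision P = Σ[ b ∈ Bool ] (ExcludedMiddle 0ℓ → Reflects P b)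

decidable : ∀ {A : Set} {P : Pred A 0ℓ} → (∀ x → Decision (P x)) → Decidable P
decidable decision = proj₁ ∘ decision , λ em x → proj₂ (decision x) em

decision-by : ∀ {P Q : Set} → Dec Q → (ExcludedMiddle 0ℓ → Q ⇔ P) → Decision P
decision-by Q? Q⇔P = does Q? , λ em → proof (Dec.map (Q⇔P em) Q?)

decision-map : ∀ {P Q : Set} → P ⇔ Q → Decision P → Decision Q
decision-map P⇔Q (b , reflects) = b , λ em → proof (Dec.map P⇔Q (b because reflects em))

infixr 2 _×-decision_
_×-decision_ : ∀ {P Q : Set} → Decision P → Decision Q → Decision (P × Q)
(b , P-reflects) ×-decision (c , Q-reflects) =
  _ , λ em → proof ((b because P-reflects em) ×-dec (c because Q-reflects em))

-- Finite types and their subsets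

-- A is a retract of some Fin size; decode need not be injective, which makes
-- products and vectors immediate.
record Finite (A : Set) : Set where
  field
    size          : ℕ
    encode        : A → Fin size
    decode        : Fin size → A
    decode∘encode : ∀ a → decode (encode a) ≡ a

  infix 4 _≟_
  _≟_ : B.DecidableEquality A
  a ≟ b = map′ (λ eq → trans (sym (decode∘encode a)) (trans (cong decode eq) (decode∘encode b)))
               (cong encode) (encode a Fin.≟ encode b)

  module _ {P : Pred A 0ℓ} (P? : U.Decidable P) where

    some? : Dec (∃ P)
    some? = map′ (λ (i , p) → decode i , p)
                 (λ (a , p) → encode a , subst P (sym (decode∘encode a)) p)
                 (Fin.any? (P? ∘ decode))

    every? : Dec (∀ a → P a)
    every? = map′ (λ p a → subst P (decode∘encode a) (p (encode a))) (_∘ decode)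
                  (Fin.all? (P? ∘ decode))

  inhabited? : Dec A
  inhabited? = map′ proj₁ (_, tt) (some? (λ _ → yes tt))

open Finite

retract : ∀ {A B} (f : A → B) (g : B → A) → (∀ a → g (f a) ≡ a) → Finite B → Finite A
retract f g g∘f fin = record
  { size = size fin
  ; encode = encode fin ∘ f
  ; decode = g ∘ decode fin
  ; decode∘encode = λ a → trans (cong g (decode∘encode fin (f a))) (g∘f a)
  }

Fin-finite : ∀ n → Finite (Fin n)
Fin-finite n = record { size = n ; encode = id ; decode = id ; decode∘encode = λ _ → refl }

Bool-finite : Finite Bool
Bool-finite = retract (λ where false → zero ; true → suc zero)
                      (λ where zero → false ; (suc zero) → true)
                      (λ where false → refl ; true → refl) (Fin-finite 2)

infixr 2 _×-finite_
_×-finite_ : ∀ {A B} → Finite A → Finite B → Finite (A × B)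
A-fin ×-finite B-fin = record
  { size = size A-fin ℕ.* size B-fin
  ; encode = λ (a , b) → combine (encode A-fin a) (encode B-fin b)
  ; decode = λ k → let i , j = remQuot (size B-fin) k in decode A-fin i , decode B-fin j
  ; decode∘encode = λ (a , b) → trans
      (cong (λ (i , j) → decode A-fin i , decode B-fin j)
            (Fin.remQuot-combine (encode A-fin a) (encode B-fin b)))
      (cong₂ _,_ (decode∘encode A-fin a) (decode∘encode B-fin b))
  }

Vec-finite : ∀ {A} → Finite A → ∀ n → Finite (Vec A n)
Vec-finite fin zero    = retract (λ _ → zero) (λ _ → []) (λ where [] → refl) (Fin-finite 1)
Vec-finite fin (suc n) = retract (λ where (a ∷ as) → a , as) (uncurry _∷_)
                                 (λ where (a ∷ as) → refl) (fin ×-finite Vec-finite fin n)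

-- Decidable subsets of S as bit vectors over the codes of its elements, so
-- that they form a finite type themselves.
module Subsets {S : Set} (fin : Finite S) where

  Subset : Set
  Subset = Vec Bool (size fin)

  infix 4 _∈ˢ_
  _∈ˢ_ : S → Subset → Set
  s ∈ˢ U = T (Vec.lookup U (encode fin s))

  _∈ˢ?_ : B.Decidable _∈ˢ_
  s ∈ˢ? U = T? _

  module _ {P : Pred S 0ℓ} (P? : U.Decidable P) where

    comprehension : Subset
    comprehension = tabulate (⌊_⌋ ∘ P? ∘ decode fin)

    private
      lookup-comprehension : ∀ s → Vec.lookup comprehension (encode fin s) ≡ ⌊ P? s ⌋
      lookup-comprehension s =
        trans (lookup∘tabulate _ (encode fin s)) (cong (⌊_⌋ ∘ P?) (decode∘encode fin s))

    ∈-comprehension⁺ : ∀ {s} → P s → s ∈ˢ comprehension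
    ∈-comprehension⁺ {s} p = subst T (sym (lookup-comprehension s)) (fromWitness {a? = P? s} p)

    ∈-comprehension⁻ : ∀ {s} → s ∈ˢ comprehension → P s
    ∈-comprehension⁻ {s} s∈ = toWitness {a? = P? s} (subst T (lookup-comprehension s) s∈)

  full : Subset
  full = comprehension (λ _ → yes tt)

  ∈-full : ∀ {s} → s ∈ˢ full
  ∈-full = ∈-comprehension⁺ (λ _ → yes tt) tt

-- Reachability in a finite graph

-- Warshall's algorithm for the reflexive transitive closure of E.
module Warshall {S : Set} (fin : Finite S) {E : Rel S 0ℓ} (E? : B.Decidable E) where

  -- Via vs s t: t can be reached from s through intermediate vertices in vs.
  Via : List S → Rel S 0ℓ
  Via []       s t = s ≡ t ⊎ E s t
  Via (v ∷ vs) s t = Via vs s t ⊎ Via vs s v × Via vs v t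

  Via? : ∀ vs → B.Decidable (Via vs)
  Via? []       s t = _≟_ fin s t ⊎-dec E? s t
  Via? (v ∷ vs) s t = Via? vs s t ⊎-dec Via? vs s v ×-dec Via? vs v t

  base⇒Via : ∀ vs {s t} → s ≡ t ⊎ E s t → Via vs s t
  base⇒Via []       p = p
  base⇒Via (v ∷ vs) p = inj₁ (base⇒Via vs p)

  Via⇒Star : ∀ vs {s t} → Via vs s t → Star E s t
  Via⇒Star []       (inj₁ refl)     = ε
  Via⇒Star []       (inj₂ e)        = e ◅ ε
  Via⇒Star (v ∷ vs) (inj₁ p)        = Via⇒Star vs p
  Via⇒Star (v ∷ vs) (inj₂ (p , p′)) = Via⇒Star vs p ◅◅ Via⇒Star vs p′

  -- Both paths can be cut at their first, respectively last, passage through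
  -- the head v of the list, so that v need not be visited twice.
  Via-trans : ∀ {m} vs → m ∈ₗ vs → ∀ {s t} → Via vs s m → Via vs m t → Via vs s t
  Via-trans (v ∷ vs) (here refl) p p′ = inj₂ ([ id , proj₁ ]′ p , [ id , proj₂ ]′ p′)
  Via-trans (v ∷ vs) (there m∈) (inj₁ p)       (inj₁ p′)       = inj₁ (Via-trans vs m∈ p p′)
  Via-trans (v ∷ vs) (there m∈) (inj₁ p)       (inj₂ (p′ , r)) = inj₂ (Via-trans vs m∈ p p′ , r)
  Via-trans (v ∷ vs) (there m∈) (inj₂ (p , r)) (inj₁ p′)       = inj₂ (p , Via-trans vs m∈ r p′)
  Via-trans (v ∷ vs) (there m∈) (inj₂ (p , _)) (inj₂ (_ , p′)) = inj₂ (p , p′)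

  vertices : List S
  vertices = List.tabulate (decode fin)

  ∈-vertices : ∀ s → s ∈ₗ vertices
  ∈-vertices s = subst (_∈ₗ vertices) (decode∘encode fin s) (∈-tabulate⁺ (encode fin s))

  Star⇒Via : ∀ {s t} → Star E s t → Via vertices s t
  Star⇒Via ε = base⇒Via vertices (inj₁ refl)
  Star⇒Via (_◅_ {j = m} e p) =
    Via-trans vertices (∈-vertices m) (base⇒Via vertices (inj₂ e)) (Star⇒Via p)

  Star? : B.Decidable (Star E)
  Star? s t = map′ (Via⇒Star vertices) Star⇒Via (Via? vertices s t)

open Warshall using (Star?)

-- Infinite paths

-- A property P of vertices that always passes on to some successor yields an
-- infinite path; edges and property may depend on time.
unfold : ∀ {S : Set} (E : ℕ → Rel S 0ℓ) (P : ℕ → Pred S 0ℓ) →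
         (∀ i {s} → P i s → ∃[ t ] E i s t × P (suc i) t) →
         ∀ {s} → P 0 s → Σ[ ρ ∈ (ℕ → S) ] ρ 0 ≡ s × ∀ i → E i (ρ i) (ρ (suc i))
unfold {S} E P step {s} p =
  proj₁ ∘ states , refl , λ i → proj₁ (proj₂ (step i (proj₂ (states i))))
  where
  states : (i : ℕ) → Σ[ s ∈ S ] P i s
  states zero    = s , p
  states (suc i) = let t , _ , p′ = step i (proj₂ (states i)) in t , p′

segment : ∀ {S : Set} {E : Rel S 0ℓ} (ρ : ℕ → S) → (∀ i → E (ρ i) (ρ (suc i))) →
          ∀ {i j} → i ≤′ j → Star E (ρ i) (ρ j)
segment ρ path ≤′-refl       = ε
segment ρ path (≤′-step i≤j) = segment ρ path i≤j ◅◅ path _ ◅ ε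

-- There is an infinite path from s that eventually stays in R.
EventualPath : ∀ {S : Set} → Rel S 0ℓ → Pred S 0ℓ → Pred S 0ℓ
EventualPath {S} E R s =
  Σ[ ρ ∈ (ℕ → S) ] ρ 0 ≡ s × (∀ i → E (ρ i) (ρ (suc i))) × ∃[ n ] ∀ i → n ≤ i → R (ρ i)

-- Such a path exists if and only if s is the origin of a lasso.
module Lasso {S : Set} {E : Rel S 0ℓ} {R : Pred S 0ℓ} where

  -- Edges starting in R.
  Inside : Rel S 0ℓ
  Inside s t = R s × E s t

  -- s lies on a nontrivial cycle whose vertices are all in R.
  OnCycle : Pred S 0ℓ
  OnCycle s = ∃[ t ] Inside s t × Star Inside t s

  -- A finite path from s to a cycle all of whose vertices lie in R.
  Lasso : Pred S 0ℓ
  Lasso s = ∃[ t ] Star E s t × OnCycle t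

  cycle⇒path : ∀ {s} → OnCycle s → EventualPath E R s
  cycle⇒path {s} (t , e , p) =
    let ρ , ρ0 , path = unfold (λ _ → Inside) (λ _ u → Star Inside u s) step ε
    in ρ , ρ0 , proj₂ ∘ path , 0 , λ i _ → proj₁ (path i)
    where
    -- A vertex u comes with the rest of the current turn around the cycle.
    step : ℕ → ∀ {u} → Star Inside u s → ∃[ v ] Inside u v × Star Inside v s
    step _ ε        = t , e , p
    step _ (e′ ◅ q) = _ , e′ , q

  prepend : ∀ {s t} → E s t → EventualPath E R t → EventualPath E R s
  prepend {s} e (ρ , refl , path , n , in-R) =
    (λ where zero → s ; (suc i) → ρ i) , refl ,
    (λ where zero → e ; (suc i) → path i) ,
    suc n , λ where (suc i) (s≤s n≤i) → in-R i n≤i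

  lasso⇒path : ∀ {s} → Lasso s → EventualPath E R s
  lasso⇒path (t , ε     , c) = cycle⇒path c
  lasso⇒path (t , e ◅ p , c) = prepend e (lasso⇒path (t , p , c))

  module _ (fin : Finite S) where

    path⇒lasso : ∀ {s} → EventualPath E R s → Lasso s
    path⇒lasso (ρ , refl , path , n , in-R)
      with i , j , i<j , ρi≡ρj ←
        Fin.pigeonhole ℕ.≤-refl (λ (i : Fin (suc (size fin))) → encode fin (ρ (n ℕ.+ toℕ i))) =
      ρ (n ℕ.+ toℕ i) , segment ρ path (ℕ.≤⇒≤′ z≤n) ,
      tail (suc (toℕ i)) , inside (toℕ i) ,
      subst (Star Inside (tail (suc (toℕ i)))) (sym same) (segment tail inside (ℕ.≤⇒≤′ i<j))
      where
      tail : ℕ → S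
      tail i = ρ (n ℕ.+ i)
      inside : ∀ i → Inside (tail i) (tail (suc i))
      inside i = in-R _ (ℕ.m≤m+n n i) , subst (E (tail i) ∘ ρ) (sym (ℕ.+-suc n i)) (path (n ℕ.+ i))
      same : tail (toℕ i) ≡ tail (toℕ j)
      same = trans (sym (decode∘encode fin _))
                   (trans (cong (decode fin) ρi≡ρj) (decode∘encode fin _))

    Lasso? : B.Decidable E → U.Decidable R → U.Decidable Lasso
    Lasso? E? R? s = some? fin λ t → Star? fin E? s t ×-dec some? fin λ u →
      Inside? t u ×-dec Star? fin Inside? u t
      where
      Inside? : B.Decidable Inside
      Inside? s t = R? s ×-dec E? s t

-- The bi-infinite sequence with the given right half, from cell 0 on, and left
-- half, numbered leftwards; position 0 of the left half is ignored.
glue : ∀ {S : Set} → (ℕ → S) → (ℕ → S) → ℤ → S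
glue right left (+ n)    = right n
glue right left -[1+ n ] = left (suc n)

glue-path : ∀ {S : Set} (E : ℤ → Rel S 0ℓ) {right left} → right 0 ≡ left 0 →
            (∀ i → E (+ i) (right i) (right (suc i))) →
            (∀ i → E -[1+ i ] (left (suc i)) (left i)) →
            ∀ z → E z (glue right left z) (glue right left (ℤ.suc z))
glue-path E eq r l (+ n)          = r n
-- Only this edge, from cell -1 to cell 0, joins the two halves.
glue-path E eq r l -[1+ zero ]    = subst (E _ _) (sym eq) (l 0)
glue-path E eq r l -[1+ (suc n) ] = l (suc n)

-- Bi-infinite paths with a prescribed vertex set at time 0 and at both ends.
module BiInfinite {S : Set} (fin : Finite S) {E : Rel S 0ℓ} (E? : B.Decidable E)
  {M R : Pred S 0ℓ} (M? : U.Decidable M) (R? : U.Decidable R) where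

  -- A bi-infinite path visiting M at time 0, both of whose ends lie in R eventually.
  MarkedPath : Set
  MarkedPath = Σ[ σ ∈ (ℤ → S) ] (∀ z → E (σ z) (σ (ℤ.suc z))) × M (σ 0ℤ) ×
               ∃[ n ] ∀ z → n ≤ ∣ z ∣ → R (σ z)

  private
    module Right = Lasso {E = E} {R}
    module Left  = Lasso {E = flip E} {R}

  markedPath? : Dec MarkedPath
  markedPath? = map′ build split
    (some? fin λ s → M? s ×-dec Right.Lasso? fin E? R? s ×-dec Left.Lasso? fin (flip E?) R? s)
    where
    build : (∃[ s ] M s × Right.Lasso s × Left.Lasso s) → MarkedPath
    build (s , m∈M , r , l)
      with right , refl , r-path , m , r∈R ← Right.lasso⇒path r
         | left , eq , l-path , n , l∈R ← Left.lasso⇒path l =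
      glue right left , glue-path (λ _ → E) (sym eq) r-path l-path , m∈M , m ℕ.⊔ n , λ where
        (+ i)    le → r∈R i (ℕ.≤-trans (ℕ.m≤m⊔n m n) le)
        -[1+ i ] le → l∈R (suc i) (ℕ.≤-trans (ℕ.m≤n⊔m m n) le)
    split : MarkedPath → ∃[ s ] M s × Right.Lasso s × Left.Lasso s
    split (σ , path , m∈M , n , σ∈R) = σ 0ℤ , m∈M ,
      Right.path⇒lasso fin {σ 0ℤ} (σ ∘ +_ , refl , path ∘ +_ , n , σ∈R ∘ +_) ,
      Left.path⇒lasso fin {σ 0ℤ} (left , refl , l-path , n , λ i →
        σ∈R (ℤ.- + i) ∘ subst (n ≤_) (sym (ℤ.∣-i∣≡∣i∣ (+ i))))
      where
      left : ℕ → S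
      left i = σ (ℤ.- + i)
      l-path : ∀ i → E (left (suc i)) (left i)
      l-path zero    = path -[1+ 0 ]
      l-path (suc i) = path -[1+ suc i ]

-- Labelled paths and compactness

-- δ s a t: the graph has an edge from s to t labelled a.
module Labelled {S A : Set} (δ : S → A → Pred S 0ℓ) where

  -- Run w s t: some path from s to t reads the word w.
  Run : List A → Rel S 0ℓ
  Run []      s t = s ≡ t
  Run (a ∷ w) s t = ∃[ u ] δ s a u × Run w u t

  run-++ : ∀ v {w s t u} → Run v s t → Run w t u → Run (v List.++ w) s u
  run-++ []      refl        r = r
  run-++ (a ∷ v) (m , e , p) r = m , e , run-++ v p r

  run-++⁻ : ∀ v {w s u} → Run (v List.++ w) s u → ∃[ t ] Run v s t × Run w t u
  run-++⁻ []      r           = _ , refl , r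
  run-++⁻ (a ∷ v) (m , e , p) = let t , p₁ , p₂ = run-++⁻ v p in t , (m , e , p₁) , p₂

  run-along : ∀ (ρ : ℕ → S) w → (∀ i → δ (ρ (toℕ i)) (lookup w i) (ρ (suc (toℕ i)))) →
              Run w (ρ 0) (ρ (length w))
  run-along ρ []      edges = refl
  run-along ρ (a ∷ w) edges = ρ 1 , edges zero , run-along (ρ ∘ suc) w (edges ∘ suc)

  -- A run followed by an infinite path of a coarser graph.
  run-extend : ∀ {E : Rel S 0ℓ} → (∀ {s a t} → δ s a t → E s t) → ∀ w {s t} → Run w s t →
    (τ : ℕ → S) → τ 0 ≡ t → (∀ i → E (τ i) (τ (suc i))) →
    Σ[ ρ ∈ (ℕ → S) ] ρ 0 ≡ s × (∀ i → E (ρ i) (ρ (suc i))) ×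
      (∀ i → δ (ρ (toℕ i)) (lookup w i) (ρ (suc (toℕ i))))
  run-extend δ⇒E []      refl        τ τ0 path = τ , τ0 , path , λ ()
  run-extend δ⇒E (a ∷ w) {s} (u , e , r) τ τ0 path
    with ρ , refl , ρ-path , edges ← run-extend δ⇒E w r τ τ0 path =
    (λ where zero → s ; (suc i) → ρ i) , refl ,
    (λ where zero → δ⇒E e ; (suc i) → ρ-path i) ,
    (λ where zero → e ; (suc i) → edges i)

-- Walk E i n s: some path of length n leaves s at time i.
Walk : ∀ {S : Set} → (ℕ → Rel S 0ℓ) → ℕ → ℕ → Pred S 0ℓ
Walk E i zero    s = ⊤
Walk E i (suc n) s = ∃[ t ] E i s t × Walk E (suc i) n t

walk-init : ∀ {S : Set} {E : ℕ → Rel S 0ℓ} n {i s} → Walk E i (suc n) s → Walk E i n s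
walk-init zero    _           = tt
walk-init (suc n) (t , e , w) = t , e , walk-init n w

module Compactness (em : ExcludedMiddle 0ℓ) where

  always-or-fails : ∀ (P : ℕ → Set) → (∀ n → P n) ⊎ (∃[ n ] ¬ P n)
  always-or-fails P with em {∃[ n ] ¬ P n}
  ... | yes fails = inj₂ fails
  ... | no ¬fails = inj₁ λ n → decidable-stable em λ ¬p → ¬fails (n , ¬p)

  antitone : ∀ (P : ℕ → Set) → (∀ n → P (suc n) → P n) → ∀ {m n} → m ≤′ n → P n → P m
  antitone P down ≤′-refl       p = p
  antitone P down (≤′-step m≤n) p = antitone P down m≤n (down _ p)

  -- The infinite pigeonhole principle: if every level of a decreasing sequence
  -- of subsets of a finite set is inhabited, some element lies in all of them.
  finite-choice : ∀ k (P : ℕ → Pred (Fin k) 0ℓ) → (∀ n i → P (suc n) i → P n i) →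
                  (∀ n → ∃ (P n)) → ∃[ i ] ∀ n → P n i
  finite-choice zero    P down some with () ← proj₁ (some 0)
  finite-choice (suc k) P down some with always-or-fails (λ n → P n zero)
  ... | inj₁ always      = zero , always
  ... | inj₂ (m , fails) =
    let i , p = finite-choice k (λ n → P n ∘ suc) (λ n → down n ∘ suc) rest in suc i , p
    where
    lower : ∀ {m n i} → m ≤ n → P n i → P m i
    lower {i = i} m≤n = antitone (λ n → P n i) (λ n → down n i) (ℕ.≤⇒≤′ m≤n)
    rest : ∀ n → ∃[ i ] P n (suc i)
    rest n with some (m ℕ.⊔ n)
    ... | zero  , p = contradiction (lower (ℕ.m≤m⊔n m n) p) fails
    ... | suc i , p = i , lower (ℕ.m≤n⊔m m n) p

  module _ {S : Set} (fin : Finite S) where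

    choice : ∀ (P : ℕ → Pred S 0ℓ) → (∀ n s → P (suc n) s → P n s) →
             (∀ n → ∃ (P n)) → ∃[ s ] ∀ n → P n s
    choice P down some =
      let i , p = finite-choice (size fin) (λ n → P n ∘ decode fin) (λ n → down n ∘ decode fin)
                    (λ n → let s , p = some n
                           in encode fin s , subst (P n) (sym (decode∘encode fin s)) p)
      in decode fin i , p

    -- The vertices from which there are arbitrarily long walks have a
    -- successor of the same kind.
    könig : ∀ (E : ℕ → Rel S 0ℓ) {s} → (∀ n → Walk E 0 n s) →
            Σ[ ρ ∈ (ℕ → S) ] ρ 0 ≡ s × ∀ i → E i (ρ i) (ρ (suc i))
    könig E = unfold E (λ i s → ∀ n → Walk E i n s) λ i {s} walks →
      let t , p = choice (λ n t → E i s t × Walk E (suc i) n t)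
                         (λ n t (e , w) → e , walk-init n w) (walks ∘ suc)
      in t , proj₁ (p 0) , proj₂ ∘ p

-- Universality: every sequence labels a path

module Universality {S A : Set} (S-fin : Finite S) (A-fin : Finite A)
  {δ : S → A → Pred S 0ℓ} (δ? : ∀ s a t → Dec (δ s a t)) where

  open Labelled δ
  open Subsets S-fin

  -- Every bi-infinite sequence of labels is read by some bi-infinite path.
  Universal : Set
  Universal = ∀ (h : ℤ → A) → Σ[ σ ∈ (ℤ → S) ] ∀ z → δ (σ z) (h z) (σ (ℤ.suc z))

  -- The vertices reached from U by an edge labelled a.
  Post : Subset → A → Pred S 0ℓ
  Post U a t = ∃[ s ] s ∈ˢ U × δ s a t

  post? : ∀ U a → U.Decidable (Post U a)
  post? U a t = some? S-fin λ s → (s ∈ˢ? U) ×-dec δ? s a t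

  post : Subset → A → Subset
  post U a = comprehension (post? U a)

  -- The end points of the runs on w that start in U.
  image : Subset → List A → Subset
  image U []      = U
  image U (a ∷ w) = image (post U a) w

  ∈-image⁺ : ∀ w {U s t} → s ∈ˢ U → Run w s t → t ∈ˢ image U w
  ∈-image⁺ []      s∈ refl = s∈
  ∈-image⁺ (a ∷ w) {U} s∈ (u , e , r) = ∈-image⁺ w (∈-comprehension⁺ (post? U a) (_ , s∈ , e)) r

  ∈-image⁻ : ∀ w {U t} → t ∈ˢ image U w → ∃[ s ] s ∈ˢ U × Run w s t
  ∈-image⁻ []      t∈ = _ , t∈ , refl
  ∈-image⁻ (a ∷ w) {U} t∈ with u , u∈ , r ← ∈-image⁻ w t∈
    with s , s∈ , e ← ∈-comprehension⁻ (post? U a) u∈ = s , s∈ , u , e , r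

  -- The transitions of the subset automaton.
  _⟶_ : Rel Subset 0ℓ
  U ⟶ V = ∃[ a ] V ≡ post U a

  Subset-finite : Finite Subset
  Subset-finite = Vec-finite Bool-finite (size S-fin)

  _⟶?_ : B.Decidable _⟶_
  U ⟶? V = some? A-fin λ a → _≟_ Subset-finite V (post U a)

  star⇒image : ∀ {U V} → Star _⟶_ U V → ∃[ w ] V ≡ image U w
  star⇒image ε = [] , refl
  star⇒image ((a , refl) ◅ p) = let w , eq = star⇒image p in a ∷ w , eq

  image⇒star : ∀ U w → Star _⟶_ U (image U w)
  image⇒star U []      = ε
  image⇒star U (a ∷ w) = (a , refl) ◅ image⇒star (post U a) w

  -- Some finite word is read by no path.
  Rejects : Set
  Rejects = ∃[ V ] Star _⟶_ full V × ∀ s → ¬ s ∈ˢ V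

  rejects? : Dec Rejects
  rejects? = some? Subset-finite λ V →
    Star? Subset-finite _⟶?_ full V ×-dec every? S-fin (λ s → ¬? (s ∈ˢ? V))

  private module _ (a₀ : A) where

    -- The letters of a word, continued by a₀.
    nth : List A → ℕ → A
    nth []      _       = a₀
    nth (a ∷ w) zero    = a
    nth (a ∷ w) (suc i) = nth w i

    nth-lookup : ∀ w i → nth w (toℕ i) ≡ lookup w i
    nth-lookup (a ∷ w) zero    = refl
    nth-lookup (a ∷ w) (suc i) = nth-lookup w i

  -- If A is empty, every graph is universal, even one without vertices, which
  -- rejects the empty word.  A letter is also needed to pad a rejected word
  -- to a sequence.
  universal⇒¬rejects : Universal → A → ¬ Rejects
  universal⇒¬rejects universal a₀ (V , reach , empty)
    with w , refl ← star⇒image reach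
    with σ , path ← universal (λ where (+ i) → nth a₀ w i ; -[1+ _ ] → a₀) =
    empty _ (∈-image⁺ w ∈-full (run-along (σ ∘ +_) w λ i →
      subst (λ a → δ _ a _) (nth-lookup a₀ w i) (path (+ toℕ i))))

  module _ (em : ExcludedMiddle 0ℓ) where
    open Compactness em

    -- The sequence h is cut into words centred at the origin.  Their runs
    -- split there, and some vertex s starts arbitrarily long half-runs in both
    -- directions.
    ¬rejects⇒universal : (A → ¬ Rejects) → Universal
    ¬rejects⇒universal ¬rejects h =
      let s , walks = choice S-fin (λ n s → Walk E⁻ 0 n s × Walk E⁺ 0 n s)
                        (λ n s (l , r) → walk-init n l , walk-init n r) both
          left  , left0  , l-path = könig S-fin E⁻ (proj₁ ∘ walks)
          right , right0 , r-path = könig S-fin E⁺ (proj₂ ∘ walks)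
      in glue right left ,
         glue-path (λ z s t → δ s (h z) t) (trans right0 (sym left0)) r-path l-path
      where
      -- The steps reading h rightwards from the origin, and backwards from it.
      E⁺ E⁻ : ℕ → Rel S 0ℓ
      E⁺ i s t = δ s (h (+ i)) t
      E⁻ i s t = δ t (h -[1+ i ]) s

      -- The letters of h on the cells i, ..., i + n - 1.
      future : ℕ → ℕ → List A
      future i zero    = []
      future i (suc n) = h (+ i) ∷ future (suc i) n

      -- The letters of h on the cells -n, ..., -1, in this order.
      past : ℕ → List A
      past zero    = []
      past (suc n) = h -[1+ n ] ∷ past n

      run⇒future : ∀ i n {s t} → Run (future i n) s t → Walk E⁺ i n s
      run⇒future i zero    _           = tt
      run⇒future i (suc n) (u , e , r) = u , e , run⇒future (suc i) n r

      -- The letters furthest from the origin come first in a run, so k counts the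
      -- steps already made from the cell -n away from it.
      run⇒past : ∀ n k {s t} → Run (past n) s t → Walk E⁻ n k s → Walk E⁻ 0 (n ℕ.+ k) t
      run⇒past zero    k refl        w = w
      run⇒past (suc n) k {t = t} (u , e , r) w =
        subst (λ m → Walk E⁻ 0 m t) (ℕ.+-suc n k) (run⇒past n (suc k) r (_ , e , w))

      both : ∀ n → ∃[ s ] Walk E⁻ 0 n s × Walk E⁺ 0 n s
      both n with em {∃[ t ] t ∈ˢ image full (past n List.++ future 0 n)}
      ... | no empty = contradiction
        (_ , image⇒star full (past n List.++ future 0 n) , λ t t∈ → empty (t , t∈))
        (¬rejects (h 0ℤ))
      ... | yes (t , t∈)
        with _ , _ , r ← ∈-image⁻ (past n List.++ future 0 n) t∈
        with s , p , f ← run-++⁻ (past n) r =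
        s , subst (λ m → Walk E⁻ 0 m s) (ℕ.+-identityʳ n) (run⇒past n 0 p tt) , run⇒future 0 n f

  universal? : Decision Universal
  universal? = decision-by (inhabited? A-fin →-dec ¬? rejects?) λ em →
    mk⇔ (¬rejects⇒universal em) universal⇒¬rejects

-- Regular expressions read along a finite graph

module Expressions {q : ℕ} {S : Set} (fin : Finite S)
  {δ : S → Fin q → Pred S 0ℓ} (δ? : ∀ s b t → Dec (δ s b t)) where

  open Labelled δ
  open Regex (Fin.≤-preorder q)
    using (Exp; ε; [_]; [^_]; _∣_; _∙_; _⋆; sum; prod; star) renaming (_∈_ to _matches_)
  open RegexProperties (DecTotalOrder.decPoset (Fin.≤-decTotalOrder q)) using (_∈?[_]; _∈?[^_])
  open Appending using (break) renaming (_++_ to _appended-to_)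

  -- Some path from s to t reads a word matched by e, as a relation that is
  -- decidable by recursion on e.
  Reads : Exp → Rel S 0ℓ
  Reads ε       s t = s ≡ t
  Reads [ rs ]  s t = ∃[ b ] (b ∷ []) matches [ rs ] × δ s b t
  Reads [^ rs ] s t = ∃[ b ] (b ∷ []) matches [^ rs ] × δ s b t
  Reads (e ∣ f) s t = Reads e s t ⊎ Reads f s t
  Reads (e ∙ f) s t = ∃[ u ] Reads e s u × Reads f u t
  Reads (e ⋆)   s t = Star (Reads e) s t

  reads? : ∀ e → B.Decidable (Reads e)
  reads? ε       s t = _≟_ fin s t
  reads? [ rs ]  s t = Fin.any? λ b → ((b ∷ []) ∈?[ rs ]) ×-dec δ? s b t
  reads? [^ rs ] s t = Fin.any? λ b → ((b ∷ []) ∈?[^ rs ]) ×-dec δ? s b t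
  reads? (e ∣ f) s t = reads? e s t ⊎-dec reads? f s t
  reads? (e ∙ f) s t = some? fin λ u → reads? e s u ×-dec reads? f u t
  reads? (e ⋆)   s t = Star? fin (reads? e) s t

  -- The specification of Reads: a run on some word matched by e.
  Accepts : Exp → Rel S 0ℓ
  Accepts e s t = ∃[ w ] w matches e × Run w s t

  reads⇒accepts : ∀ e {s t} → Reads e s t → Accepts e s t
  reads⇒accepts ε       refl        = [] , ε , refl
  reads⇒accepts [ rs ]  (b , m , d) = b ∷ [] , m , _ , d , refl
  reads⇒accepts [^ rs ] (b , m , d) = b ∷ [] , m , _ , d , refl
  reads⇒accepts (e ∣ f) (inj₁ r) = let w , m , p = reads⇒accepts e r in w , sum (inj₁ m) , p
  reads⇒accepts (e ∣ f) (inj₂ r) = let w , m , p = reads⇒accepts f r in w , sum (inj₂ m) , p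
  reads⇒accepts (e ∙ f) (u , r , r′) =
    let v , m , p = reads⇒accepts e r ; w , m′ , p′ = reads⇒accepts f r′
    in v List.++ w , prod (v appended-to w) m m′ , run-++ v p p′
  reads⇒accepts (e ⋆) ε = [] , star (sum (inj₁ ε)) , refl
  reads⇒accepts (e ⋆) (r ◅ rs) =
    let v , m , p = reads⇒accepts e r ; w , m′ , p′ = reads⇒accepts (e ⋆) rs
    in v List.++ w , star (sum (inj₂ (prod (v appended-to w) m m′))) , run-++ v p p′

  accepts⇒reads : ∀ {e w s t} → w matches e → Run w s t → Reads e s t
  accepts⇒reads ε      refl           = refl
  accepts⇒reads [ m ]  (_ , d , refl) = _ , [ m ] , d
  accepts⇒reads [^ m ] (_ , d , refl) = _ , [^ m ] , d
  accepts⇒reads (sum (inj₁ m)) p = inj₁ (accepts⇒reads m p)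
  accepts⇒reads (sum (inj₂ m)) p = inj₂ (accepts⇒reads m p)
  accepts⇒reads (prod {v = v} app m m′) p rewrite sym (break app)
    with u , p₁ , p₂ ← run-++⁻ v p = u , accepts⇒reads m p₁ , accepts⇒reads m′ p₂
  accepts⇒reads (star (sum (inj₁ ε))) refl = ε
  accepts⇒reads (star (sum (inj₂ (prod {v = v} app m m′)))) p rewrite sym (break app)
    with u , p₁ , p₂ ← run-++⁻ v p = accepts⇒reads m p₁ ◅ accepts⇒reads m′ p₂

-- Local constraints and windows

i-j+j≡i : ∀ i j → i - j + j ≡ i
i-j+j≡i i j = trans (ℤ.+-assoc i (ℤ.- j) j)
                    (trans (cong (ℤ._+_ i) (ℤ.+-inverseˡ j)) (ℤ.+-identityʳ i))

i+j-j≡i : ∀ i j → i + j - j ≡ i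
i+j-j≡i i j = trans (ℤ.+-assoc i j (ℤ.- j))
                    (trans (cong (ℤ._+_ i) (ℤ.+-inverseʳ j)) (ℤ.+-identityʳ i))

module _ {C : Set} where

  shift : ℤ → (ℤ → C) → ℤ → C
  shift z x v = x (z + v)

  -- x and y coincide on the cells -k, ..., k.
  Agree : ℕ → Rel (ℤ → C) 0ℓ
  Agree k x y = ∀ v → ∣ v ∣ ≤ k → x v ≡ y v

  -- P only depends on the cells -k, ..., k.
  Local : ℕ → Pred (ℤ → C) 0ℓ → Set
  Local k P = ∀ {x y} → Agree k x y → P x → P y

  Agree-≤ : ∀ {j k} → j ≤ k → ∀ {x y} → Agree k x y → Agree j x y
  Agree-≤ j≤k agree v le = agree v (ℕ.≤-trans le j≤k)

module Windows (C : Set) (k : ℕ) where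

  -- The contents of the cells -k, ..., k.
  Window : Set
  Window = Vec C (suc (k ℕ.+ k))

  -- The index of cell v in a window.  The reduction modulo 2k+1 only makes slot
  -- total and does nothing for cells inside the window.
  slot : ℤ → Fin (suc (k ℕ.+ k))
  slot v = ∣ v + + k ∣ mod suc (k ℕ.+ k)

  -- A window as a configuration; cells outside of it get arbitrary letters.
  at : Window → ℤ → C
  at u v = Vec.lookup u (slot v)

  cell : (ℤ → C) → ℤ → Fin (suc (k ℕ.+ k)) → C
  cell x z i = x (z + (+ toℕ i - + k))

  -- The window of x centred at cell z.
  read : (ℤ → C) → ℤ → Window
  read x z = tabulate (cell x z)

  toℕ-slot : ∀ v → ∣ v + + k ∣ ≤ k ℕ.+ k → toℕ (slot v) ≡ ∣ v + + k ∣
  toℕ-slot v le = trans (Fin.toℕ-fromℕ< _) (m≤n⇒m%n≡m le)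

  slot-near : ∀ v → ∣ v ∣ ≤ k → + toℕ (slot v) ≡ v + + k
  slot-near v le = trans
    (cong +_ (toℕ-slot v (ℕ.≤-trans (ℤ.∣i+j∣≤∣i∣+∣j∣ v (+ k)) (ℕ.+-monoˡ-≤ k le))))
    (ℤ.0≤i⇒+∣i∣≡i (nonneg v le))
    where
    nonneg : ∀ v → ∣ v ∣ ≤ k → 0ℤ ℤ.≤ v + + k
    nonneg (+ n)    _  = ℤ.+≤+ z≤n
    nonneg -[1+ n ] le = subst (0ℤ ℤ.≤_) (sym (ℤ.⊖-≥ le)) (ℤ.+≤+ z≤n)

  at-read : ∀ x z → Agree k (at (read x z)) (shift z x)
  at-read x z v le = trans (lookup∘tabulate (cell x z) (slot v))
    (cong (λ i → x (z + i)) (trans (cong (_- + k) (slot-near v le)) (i+j-j≡i v (+ k))))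

  read-at : ∀ u → read (at u) 0ℤ ≡ u
  read-at u = trans (tabulate-cong (cong (Vec.lookup u) ∘ slot-offset)) (tabulate∘lookup u)
    where
    slot-offset : ∀ i → slot (0ℤ + (+ toℕ i - + k)) ≡ i
    slot-offset i = Fin.toℕ-injective (trans
      (toℕ-slot (0ℤ + (+ toℕ i - + k)) (subst (_≤ k ℕ.+ k) (sym eq) (Fin.toℕ≤pred[n] i))) eq)
      where
      eq : ∣ 0ℤ + (+ toℕ i - + k) + + k ∣ ≡ toℕ i
      eq = cong ∣_∣ (trans (cong (_+ + k) (ℤ.+-identityˡ (+ toℕ i - + k)))
                           (i-j+j≡i (+ toℕ i) (+ k)))

  -- The window v can lie one cell to the right of the window u.
  infix 4 _↝_
  _↝_ : Rel Window 0ℓ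
  u ↝ v = ∀ (i : Fin (k ℕ.+ k)) → Vec.lookup u (suc i) ≡ Vec.lookup v (inject₁ i)

  read-↝ : ∀ x z → read x z ↝ read x (ℤ.suc z)
  read-↝ x z i = trans (lookup∘tabulate (cell x z) (suc i))
    (trans (cong x eq) (sym (lookup∘tabulate (cell x (ℤ.suc z)) (inject₁ i))))
    where
    eq : z + (+ suc (toℕ i) - + k) ≡ 1ℤ + z + (+ toℕ (inject₁ i) - + k)
    eq rewrite Fin.toℕ-inject₁ i =
      trans (cong (ℤ._+_ z) (ℤ.+-assoc 1ℤ (+ toℕ i) (ℤ.- + k)))
            (trans (sym (ℤ.+-assoc z 1ℤ _)) (cong (_+ (+ toℕ i - + k)) (ℤ.+-comm z 1ℤ)))

  -- The configuration spelled by the central cells of a sequence of windows.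
  centres : (ℤ → Window) → ℤ → C
  centres σ z = at (σ z) 0ℤ

  -- Along a path, every window is the window of the configuration that the
  -- path spells.  Everything is compared with the first letters of the windows.
  at-path : ∀ (σ : ℤ → Window) → (∀ z → σ z ↝ σ (ℤ.suc z)) →
            ∀ z → Agree k (at (σ z)) (shift z (centres σ))
  at-path σ path z v le = trans (at-first z v le) (sym (trans (at-first (z + v) 0ℤ z≤n)
                                                            (cong first eq)))
    where
    first : ℤ → C
    first z = Vec.lookup (σ z) zero
    lookup-first : ∀ i z → Vec.lookup (σ z) i ≡ first (z + + toℕ i)
    lookup-first = <-weakInduction _ (λ z → cong first (sym (ℤ.+-identityʳ z))) λ i ih z →
      trans (path z i) (trans (ih (ℤ.suc z)) (cong first (next i z)))
      where
      next : ∀ i z → 1ℤ + z + + toℕ (inject₁ i) ≡ z + + suc (toℕ i)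
      next i z rewrite Fin.toℕ-inject₁ i =
        trans (cong (_+ + toℕ i) (ℤ.+-comm 1ℤ z)) (ℤ.+-assoc z 1ℤ (+ toℕ i))
    at-first : ∀ z v → ∣ v ∣ ≤ k → at (σ z) v ≡ first (z + (v + + k))
    at-first z v le = trans (lookup-first (slot v) z) (cong (first ∘ (ℤ._+_ z)) (slot-near v le))
    eq : z + v + (0ℤ + + k) ≡ z + (v + + k)
    eq = ℤ.+-assoc z v (+ k)

  module _ (C-finite : Finite C) where

    Window-finite : Finite Window
    Window-finite = Vec-finite C-finite _

    _↝?_ : B.Decidable _↝_
    u ↝? v = Fin.all? λ i → _≟_ C-finite (Vec.lookup u (suc i)) (Vec.lookup v (inject₁ i))

-- Three decision problems on subshifts

-- The configurations that satisfy a local constraint P at every cell.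
module Subshift {C : Set} (C-finite : Finite C) (k : ℕ)
  {P : Pred (ℤ → C) 0ℓ} (P? : U.Decidable P) (local : Local k P) where

  open Windows C k

  Valid : Pred (ℤ → C) 0ℓ
  Valid x = ∀ z → P (shift z x)

  -- The graph whose bi-infinite paths are the valid configurations.
  Edge : Rel Window 0ℓ
  Edge u v = u ↝ v × P (at u)

  edge? : B.Decidable Edge
  edge? u v = _↝?_ C-finite u v ×-dec P? (at u)

  valid⇒path : ∀ x → Valid x → ∀ z → Edge (read x z) (read x (ℤ.suc z))
  valid⇒path x valid z = read-↝ x z , local (λ v le → sym (at-read x z v le)) (valid z)

  path⇒valid : ∀ σ → (∀ z → Edge (σ z) (σ (ℤ.suc z))) → Valid (centres σ)
  path⇒valid σ path z = local (at-path σ (proj₁ ∘ path) z) (proj₂ (path z))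

  centre-read : ∀ x z → at (read x z) 0ℤ ≡ x z
  centre-read x z = trans (at-read x z 0ℤ z≤n) (cong x (ℤ.+-identityʳ z))

  shift-valid : ∀ x z → Valid x → Valid (shift z x)
  shift-valid x z valid w =
    local {shift (z + w) x} (λ v _ → cong x (ℤ.+-assoc z w v)) (valid (z + w))

  module _ {M R : Pred C 0ℓ} (M? : U.Decidable M) (R? : U.Decidable R) where

    -- Some valid configuration has its letter at 0 in M and its letters far from 0
    -- in R.
    Marked : Set
    Marked = Σ[ x ∈ (ℤ → C) ] Valid x × M (x 0ℤ) × ∃[ n ] ∀ z → n ≤ ∣ z ∣ → R (x z)

    marked-at : ∀ x → Valid x → ∀ z → M (x z) → (∃[ n ] ∀ v → n ≤ ∣ v ∣ → R (x v)) → Marked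
    marked-at x valid z m (n , r) =
      shift z x , shift-valid x z valid , subst M (cong x (sym (ℤ.+-identityʳ z))) m ,
      n ℕ.+ ∣ z ∣ ,
      λ v le → r (z + v) (ℕ.+-cancelʳ-≤ ∣ z ∣ n (∣ z + v ∣) (ℕ.≤-trans le (triangle v)))
      where
      triangle : ∀ v → ∣ v ∣ ≤ ∣ z + v ∣ ℕ.+ ∣ z ∣
      triangle v = subst (λ w → ∣ w ∣ ≤ ∣ z + v ∣ ℕ.+ ∣ z ∣)
        (trans (cong (_- z) (ℤ.+-comm z v)) (i+j-j≡i v z)) (ℤ.∣i-j∣≤∣i∣+∣j∣ (z + v) z)

    marked? : Dec Marked
    marked? = map′
      (λ (σ , path , m , n , r) → centres σ , path⇒valid σ path , m , n , r)
      (λ (x , valid , m , n , r) →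
        read x , valid⇒path x valid , subst M (sym (centre-read x 0ℤ)) m ,
        n , λ z le → subst R (sym (centre-read x z)) (r z le))
      (BiInfinite.markedPath? (Window-finite C-finite) edge?
        (λ u → M? (at u 0ℤ)) (λ u → R? (at u 0ℤ)))

-- Which sequences are the first track of a valid configuration over A × H.
module Extension {A H : Set} (A-finite : Finite A) (H-finite : Finite H) (k : ℕ)
  {P : Pred (ℤ → A × H) 0ℓ} (P? : U.Decidable P) (local : Local k P) where

  open Windows (A × H) k
  open Subshift (A-finite ×-finite H-finite) k P? local

  -- Every sequence over A is the first track of a valid configuration.
  Extendable : Set
  Extendable = ∀ (a : ℤ → A) → Σ[ h ∈ (ℤ → H) ] Valid (λ z → a z , h z)

  -- Edges between windows, labelled by the first track of the central cell.
  δ : Window → A → Pred Window 0ℓ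
  δ u a v = Edge u v × proj₁ (at u 0ℤ) ≡ a

  open Universality (Window-finite (A-finite ×-finite H-finite)) A-finite {δ}
    (λ u a v → edge? u v ×-dec _≟_ A-finite (proj₁ (at u 0ℤ)) a)
    using (Universal; universal?)

  extendable⇒universal : Extendable → Universal
  extendable⇒universal extend a =
    let h , valid = extend a
        x = λ z → a z , h z
    in read x , λ z → valid⇒path x valid z , cong proj₁ (centre-read x z)

  universal⇒extendable : Universal → Extendable
  universal⇒extendable universal a =
    let σ , path = universal a
        x = centres σ
        labels = λ z → proj₂ (path z)
    in proj₂ ∘ x , λ z →
      local {shift z x} (λ v _ → cong (_, proj₂ (x (z + v))) (labels (z + v)))
            (path⇒valid σ (proj₁ ∘ path) z)

  extendable? : Decision Extendable
  extendable? = decision-map (mk⇔ universal⇒extendable extendable⇒universal) universal?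

-- Words read along a configuration, one local constraint P b per letter b.
module Language {C : Set} (C-finite : Finite C) (k : ℕ) {q : ℕ}
  {P : Fin q → Pred (ℤ → C) 0ℓ} (P? : ∀ b → U.Decidable (P b)) (local : ∀ b → Local k (P b)) where

  open Windows C k
  open Regex (Fin.≤-preorder q) using (Exp) renaming (_∈_ to _matches_)

  -- An edge reads b if the window at its source satisfies the constraint of b.
  δ : Window → Fin q → Pred Window 0ℓ
  δ u b v = u ↝ v × P b (at u)

  open Labelled δ
  open Expressions (Window-finite C-finite) (λ u b v → _↝?_ C-finite u v ×-dec P? b (at u))

  -- Some configuration satisfies, for some word w matched by e, the constraint
  -- of the i-th letter of w at cell i.
  Produces : Exp → Set
  Produces e = ∃[ w ] w matches e × Σ[ x ∈ (ℤ → C) ] (∀ i → P (lookup w i) (shift (+ toℕ i) x))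

  produces? : ∀ e → Dec (Produces e)
  produces? e = map′ build split
    (some? (Window-finite C-finite) λ u → some? (Window-finite C-finite) λ v → reads? e u v)
    where
    build : (∃[ u ] ∃[ v ] Reads e u v) → Produces e
    build (u , v , r)
      with w , m , run ← reads⇒accepts e r
      with ρ , ρ0 , path , edges ← run-extend {E = _↝_} proj₁ w run
             (λ i → read (at v) (+ i)) (read-at v) (λ i → read-↝ (at v) (+ i)) =
      w , m , centres σ , λ i → local _ (at-path σ σ-path (+ toℕ i)) (proj₂ (edges i))
      where
      -- Any single window extends to a whole configuration, hence the run extends
      -- to a bi-infinite path.
      left : ℕ → Window
      left i = read (at u) (ℤ.- + i)
      left-path : ∀ i → left (suc i) ↝ left i
      left-path zero    = read-↝ (at u) -[1+ 0 ]
      left-path (suc i) = read-↝ (at u) -[1+ suc i ]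
      σ : ℤ → Window
      σ = glue ρ left
      σ-path : ∀ z → σ z ↝ σ (ℤ.suc z)
      σ-path = glue-path (λ _ → _↝_) (trans ρ0 (sym (read-at u))) path left-path
    split : Produces e → ∃[ u ] ∃[ v ] Reads e u v
    split (w , m , x , p) =
      _ , _ , accepts⇒reads m (run-along (λ i → read x (+ i)) w λ i →
        read-↝ x (+ toℕ i) , local _ (λ v le → sym (at-read x (+ toℕ i) v le)) (p i))

-- Stochastic cellular automata as local rules

-- The largest absolute value in a vector of integers.
bound : ∀ {n} → Vec ℤ n → ℕ
bound []       = 0
bound (v ∷ vs) = ∣ v ∣ ℕ.⊔ bound vs

module _ {A : Set} where

  map-local : ∀ {n} (vs : Vec ℤ n) {x y : ℤ → A} → Agree (bound vs) x y →
              Vec.map x vs ≡ Vec.map y vs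
  map-local []       agree = refl
  map-local (v ∷ vs) agree =
    cong₂ _∷_ (agree v (ℕ.m≤m⊔n ∣ v ∣ _))
              (map-local vs (Agree-≤ (ℕ.m≤n⊔m ∣ v ∣ _) agree))

  -- The function sending the entries of vs to those of ws, and other cells to a.
  assign : ∀ {n} → Vec ℤ n → Vec A n → A → ℤ → A
  assign []       []       a z = a
  assign (v ∷ vs) (w ∷ ws) a z with z ℤ.≟ v
  ... | yes _ = w
  ... | no  _ = assign vs ws a z

  map-assign : ∀ {n} {vs : Vec ℤ n} → Unique vs → ∀ ws a → Vec.map (assign vs ws a) vs ≡ ws
  map-assign AllPairs.[] [] a = refl
  map-assign {vs = v ∷ vs} (v∉ AllPairs.∷ unique) (w ∷ ws) a =
    cong₂ _∷_ head (trans (skip vs v∉) (map-assign unique ws a))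
    where
    head : assign (v ∷ vs) (w ∷ ws) a v ≡ w
    head with v ℤ.≟ v
    ... | yes _  = refl
    ... | no v≢v = contradiction refl v≢v
    skip : ∀ {m} (us : Vec ℤ m) → All.All (v ≢_) us →
           Vec.map (assign (v ∷ vs) (w ∷ ws) a) us ≡ Vec.map (assign vs ws a) us
    skip []       All.[]          = refl
    skip (u ∷ us) (v≢u All.∷ v∉) with u ℤ.≟ v
    ... | yes u≡v = contradiction (sym u≡v) v≢u
    ... | no  _   = cong (_ ∷_) (skip us v∉)

module _ {q : ℕ} (F : SCA q) where
  open SCA F using (f; V; V′)

  -- The new state of cell 0.  The value of the global function at z is
  -- definitionally the rule at the configurations shifted by z.
  rule : Config q → Config (r F) → Fin q
  rule c s = f (Vec.map c V) (Vec.map s V′)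

  -- Both neighbourhoods lie in the cells -radius, ..., radius.
  radius : ℕ
  radius = bound V ℕ.⊔ bound V′

  rule-local : ∀ {c c′ s s′} → Agree radius c c′ → Agree radius s s′ → rule c s ≡ rule c′ s′
  rule-local c~c′ s~s′ = cong₂ f (map-local V (Agree-≤ (ℕ.m≤m⊔n (bound V) (bound V′)) c~c′))
                                 (map-local V′ (Agree-≤ (ℕ.m≤n⊔m (bound V) (bound V′)) s~s′))

  -- The state of cell 0 after t steps; S carries the random symbols of all steps,
  -- those of the last step first.
  orbit : ∀ t → Config q → (ℤ → Vec (Fin (r F)) t) → Fin q
  orbit zero    c S = c 0ℤ
  orbit (suc t) c S = rule (λ z → orbit t (shift z c) (Vec.tail ∘ shift z S)) (Vec.head ∘ S)

  orbit-local : ∀ t {c c′ S S′} → Agree (t ℕ.* radius) c c′ → Agree (t ℕ.* radius) S S′ →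
                orbit t c S ≡ orbit t c′ S′
  orbit-local zero    c~c′ S~S′ = c~c′ 0ℤ z≤n
  orbit-local (suc t) c~c′ S~S′ = rule-local
    (λ z z≤ → orbit-local t (λ v v≤ → c~c′ (z + v) (near z v z≤ v≤))
                            (λ v v≤ → cong Vec.tail (S~S′ (z + v) (near z v z≤ v≤))))
    (λ z z≤ → cong Vec.head (S~S′ z (ℕ.≤-trans z≤ (ℕ.m≤m+n radius _))))
    where
    near : ∀ z v → ∣ z ∣ ≤ radius → ∣ v ∣ ≤ t ℕ.* radius → ∣ z + v ∣ ≤ radius ℕ.+ t ℕ.* radius
    near z v z≤ v≤ = ℕ.≤-trans (ℤ.∣i+j∣≤∣i∣+∣j∣ z v) (ℕ.+-mono-≤ z≤ v≤)

  -- The configuration after t steps.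
  final : ∀ t → Config q → (ℤ → Vec (Fin (r F)) t) → Config q
  final t c S z = orbit t (shift z c) (shift z S)

  final-suc : ∀ t c S z → final (suc t) c S z ≡ global F (final t c (Vec.tail ∘ S)) (Vec.head ∘ S) z
  final-suc t c S z = rule-local
    (λ v _ → orbit-local t (λ w _ → cong c (sym (ℤ.+-assoc z v w)))
                           (λ w _ → cong (Vec.tail ∘ S) (sym (ℤ.+-assoc z v w))))
    (λ _ _ → refl)

  𝒩^⇒final : ∀ t {c d} → 𝒩^ t F c d → ∃[ S ] final t c S ≗ d
  𝒩^⇒final zero    {c} c≗d = (λ _ → []) , λ z → trans (cong c (ℤ.+-identityʳ z)) (c≗d z)
  𝒩^⇒final (suc t) {c} (c′ , c′∈ , s , eq) =
    let S , S-eq = 𝒩^⇒final t c′∈ in (λ z → s z ∷ S z) , λ z →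
      trans (final-suc t c (λ z → s z ∷ S z) z)
            (trans (rule-local (λ v _ → S-eq (z + v)) (λ _ _ → refl)) (eq z))

  final⇒𝒩^ : ∀ t {c d} S → final t c S ≗ d → 𝒩^ t F c d
  final⇒𝒩^ zero    {c} S eq = λ z → trans (cong c (sym (ℤ.+-identityʳ z))) (eq z)
  final⇒𝒩^ (suc t) {c} S eq =
    final t c (Vec.tail ∘ S) , final⇒𝒩^ t (Vec.tail ∘ S) (λ _ → refl) ,
    Vec.head ∘ S , λ z → trans (sym (final-suc t c S z)) (eq z)

-- The seven problems

module Noise {q : ℕ} (F : SCA q) where

  -- The tracks are a configuration, its intended image, and random symbols.
  Hits : Pred (ℤ → (Fin q × Fin q) × Fin (r F)) 0ℓ
  Hits x = rule F (proj₁ ∘ proj₁ ∘ x) (proj₂ ∘ x) ≡ proj₂ (proj₁ (x 0ℤ))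

  hits-local : Local (radius F) Hits
  hits-local agree hit = trans
    (sym (rule-local F (λ v le → cong (proj₁ ∘ proj₁) (agree v le))
                       (λ v le → cong proj₂ (agree v le))))
    (trans hit (cong (proj₂ ∘ proj₁) (agree 0ℤ z≤n)))

  open Extension (Fin-finite q ×-finite Fin-finite q) (Fin-finite (r F)) (radius F)
    {Hits} (λ x → _ Fin.≟ _) hits-local

  extendable⇒noisy : Extendable → Noisy F
  extendable⇒noisy ext c = _ , λ {d} _ →
    let s , hit = ext (λ z → c z , d z) in s , λ z → trans (hit z) (cong d (ℤ.+-identityʳ z))

  noisy⇒extendable : Noisy F → Extendable
  noisy⇒extendable noisy a =
    let s , eq = proj₂ (noisy (proj₁ ∘ a)) {proj₂ ∘ a} _
    in s , λ z → trans (eq z) (cong (proj₂ ∘ a) (sym (ℤ.+-identityʳ z)))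

  noisy? : Decision (Noisy F)
  noisy? = decision-map (mk⇔ extendable⇒noisy noisy⇒extendable) extendable?

module Surjection {q : ℕ} (F : SCA q) where

  -- The tracks are the intended image, a preimage, and random symbols.
  Hits : Pred (ℤ → Fin q × Fin q × Fin (r F)) 0ℓ
  Hits x = rule F (proj₁ ∘ proj₂ ∘ x) (proj₂ ∘ proj₂ ∘ x) ≡ proj₁ (x 0ℤ)

  hits-local : Local (radius F) Hits
  hits-local agree hit = trans
    (sym (rule-local F (λ v le → cong (proj₁ ∘ proj₂) (agree v le))
                       (λ v le → cong (proj₂ ∘ proj₂) (agree v le))))
    (trans hit (cong proj₁ (agree 0ℤ z≤n)))

  open Extension (Fin-finite q) (Fin-finite q ×-finite Fin-finite (r F)) (radius F)
    {Hits} (λ x → _ Fin.≟ _) hits-local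

  extendable⇒surjective : Extendable → Surjective F
  extendable⇒surjective ext c =
    let h , hit = ext c in proj₁ ∘ h , proj₂ ∘ h , λ z → trans (hit z) (cong c (ℤ.+-identityʳ z))

  surjective⇒extendable : Surjective F → Extendable
  surjective⇒extendable surj c =
    let c′ , s , eq = surj c
    in (λ z → c′ z , s z) , λ z → trans (eq z) (cong c (sym (ℤ.+-identityʳ z)))

  surjective? : Decision (Surjective F)
  surjective? = decision-map (mk⇔ extendable⇒surjective surjective⇒extendable) extendable?

module Inclusion {q : ℕ} (t : ℕ) (F G : SCA q) where

  -- The tracks are an initial configuration, t random configurations for F, and
  -- t random configurations for G; both automata yield the same state.
  Same : Pred (ℤ → (Fin q × Vec (Fin (r F)) t) × Vec (Fin (r G)) t) 0ℓ
  Same x = orbit F t (proj₁ ∘ proj₁ ∘ x) (proj₂ ∘ proj₁ ∘ x) ≡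
           orbit G t (proj₁ ∘ proj₁ ∘ x) (proj₂ ∘ x)

  same-local : Local (t ℕ.* radius F ℕ.⊔ t ℕ.* radius G) Same
  same-local {x} {y} agree eq = trans
    (sym (orbit-local F t (λ v le → cong (proj₁ ∘ proj₁) (F-agree v le))
                          (λ v le → cong (proj₂ ∘ proj₁) (F-agree v le))))
    (trans eq (orbit-local G t (λ v le → cong (proj₁ ∘ proj₁) (G-agree v le))
                               (λ v le → cong proj₂ (G-agree v le))))
    where
    F-agree : Agree (t ℕ.* radius F) x y
    F-agree = Agree-≤ (ℕ.m≤m⊔n _ (t ℕ.* radius G)) agree
    G-agree : Agree (t ℕ.* radius G) x y
    G-agree = Agree-≤ (ℕ.m≤n⊔m (t ℕ.* radius F) _) agree

  open Extension (Fin-finite q ×-finite Vec-finite (Fin-finite (r F)) t)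
    (Vec-finite (Fin-finite (r G)) t)
    (t ℕ.* radius F ℕ.⊔ t ℕ.* radius G) {Same} (λ x → _ Fin.≟ _) same-local

  extendable⇒inclusion : Extendable → ∀ c → 𝒩^ t F c ⊆ 𝒩^ t G c
  extendable⇒inclusion ext c d∈ =
    let S , eq = 𝒩^⇒final F t d∈ ; S′ , same = ext (λ z → c z , S z)
    in final⇒𝒩^ G t S′ (λ z → trans (sym (same z)) (eq z))

  inclusion⇒extendable : (∀ c → 𝒩^ t F c ⊆ 𝒩^ t G c) → Extendable
  inclusion⇒extendable incl a =
    let S′ , eq = 𝒩^⇒final G t (incl (proj₁ ∘ a) (final⇒𝒩^ F t (proj₂ ∘ a) λ _ → refl))
    in S′ , λ z → sym (eq z)

  inclusion? : Decision (∀ c → 𝒩^ t F c ⊆ 𝒩^ t G c)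
  inclusion? = decision-map (mk⇔ extendable⇒inclusion inclusion⇒extendable) extendable?

equality? : ∀ {q} t (F G : SCA q) → Decision (∀ c → 𝒩^ t F c ≐ 𝒩^ t G c)
equality? t F G = decision-map
  (mk⇔ (λ (F⊆G , G⊆F) c → (λ {d} → F⊆G c {d}) , (λ {d} → G⊆F c {d}))
       (λ F≐G → (λ c {d} → proj₁ (F≐G c) {d}) , (λ c {d} → proj₂ (F≐G c) {d})))
  (Inclusion.inclusion? t F G ×-decision Inclusion.inclusion? t G F)

-- Two configurations with equal images that differ at 0 and are R-related far
-- from 0.  The universal R serves injectivity, equality serves
-- pre-injectivity.
module Collisions {q : ℕ} (F : SCA q) {R : Pred (Fin q × Fin q) 0ℓ} (R? : U.Decidable R) where

  -- Two states, and the random symbols that go with them.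
  Letter : Set
  Letter = (Fin q × Fin q) × Fin (r F) × Fin (r F)

  -- The two configurations get the same state in cell 0.
  Collide : Pred (ℤ → Letter) 0ℓ
  Collide x = rule F (proj₁ ∘ proj₁ ∘ x) (proj₁ ∘ proj₂ ∘ x) ≡
              rule F (proj₂ ∘ proj₁ ∘ x) (proj₂ ∘ proj₂ ∘ x)

  collide-local : Local (radius F) Collide
  collide-local agree eq = trans
    (sym (rule-local F (λ v le → cong (proj₁ ∘ proj₁) (agree v le))
                       (λ v le → cong (proj₁ ∘ proj₂) (agree v le))))
    (trans eq (rule-local F (λ v le → cong (proj₂ ∘ proj₁) (agree v le))
                            (λ v le → cong (proj₂ ∘ proj₂) (agree v le))))

  Differ : Pred Letter 0ℓ
  Differ x = proj₁ (proj₁ x) ≢ proj₂ (proj₁ x)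

  open Subshift
    ((Fin-finite q ×-finite Fin-finite q) ×-finite Fin-finite (r F) ×-finite Fin-finite (r F))
    (radius F) {Collide} (λ x → _ Fin.≟ _) collide-local

  differ? : U.Decidable Differ
  differ? x = ¬? (_ Fin.≟ _)

  Collision : Set
  Collision = Marked differ? (R? ∘ proj₁)

  collision? : Dec Collision
  collision? = marked? differ? (R? ∘ proj₁)

  -- The two configurations are R-related outside a bounded region.
  Eventually : Config q → Config q → Set
  Eventually c₁ c₂ = ∃[ n ] ∀ z → n ≤ ∣ z ∣ → R (c₁ z , c₂ z)

  no-collision⇒injective : ¬ Collision → ∀ c₁ c₂ s₁ s₂ → Eventually c₁ c₂ →
                           global F c₁ s₁ ≗ global F c₂ s₂ → c₁ ≗ c₂
  no-collision⇒injective none c₁ c₂ s₁ s₂ tails eq z =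
    decidable-stable (c₁ z Fin.≟ c₂ z) λ c₁z≢c₂z →
    none (marked-at differ? (R? ∘ proj₁) (λ z → (c₁ z , c₂ z) , s₁ z , s₂ z) eq z c₁z≢c₂z tails)

  injective⇒no-collision : (∀ c₁ c₂ s₁ s₂ → Eventually c₁ c₂ →
                            global F c₁ s₁ ≗ global F c₂ s₂ → c₁ ≗ c₂) → ¬ Collision
  injective⇒no-collision inj (x , eq , differ , tails) =
    differ (inj (proj₁ ∘ proj₁ ∘ x) (proj₂ ∘ proj₁ ∘ x)
                (proj₁ ∘ proj₂ ∘ x) (proj₂ ∘ proj₂ ∘ x) tails eq 0ℤ)

module _ {q : ℕ} {c₁ c₂ : Config q} where

  differFinitely⇒bounded : DifferFinitely c₁ c₂ → ∃[ n ] ∀ z → n ≤ ∣ z ∣ → c₁ z ≡ c₂ z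
  differFinitely⇒bounded (zs , differ) =
    let n , below = bounded zs in n , λ z n≤z → decidable-stable (c₁ z Fin.≟ c₂ z) λ ne →
      ℕ.<⇒≱ (below (differ z ne)) n≤z
    where
    bounded : ∀ zs → ∃[ n ] ∀ {z} → z ∈ₗ zs → ∣ z ∣ < n
    bounded []       = 0 , λ ()
    bounded (z ∷ zs) = let n , below = bounded zs in suc ∣ z ∣ ℕ.⊔ n , λ where
      (here refl) → ℕ.m≤m⊔n (suc ∣ z ∣) n
      (there z∈)  → ℕ.≤-trans (below z∈) (ℕ.m≤n⊔m (suc ∣ z ∣) n)

  bounded⇒differFinitely : (∃[ n ] ∀ z → n ≤ ∣ z ∣ → c₁ z ≡ c₂ z) → DifferFinitely c₁ c₂
  bounded⇒differFinitely (n , equal) =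
    List.map +_ (List.upTo n) List.++ List.map -[1+_] (List.upTo n) ,
    λ z ne → inside z (ℕ.≰⇒> (ne ∘ equal z))
    where
    inside : ∀ z → ∣ z ∣ < n → z ∈ₗ List.map +_ (List.upTo n) List.++ List.map -[1+_] (List.upTo n)
    inside (+ i)    i<n = ∈-++⁺ˡ (∈-map⁺ +_ (∈-upTo⁺ i<n))
    inside -[1+ i ] i<n = ∈-++⁺ʳ (List.map +_ (List.upTo n))
      (∈-map⁺ -[1+_] (∈-upTo⁺ (ℕ.<-trans (ℕ.n<1+n i) i<n)))

module _ {q : ℕ} (F : SCA q) where

  injective? : Decision (Injective F)
  injective? = decision-by (¬? collision?) λ _ → mk⇔
    (λ none c₁ c₂ s₁ s₂ → no-collision⇒injective none c₁ c₂ s₁ s₂ (0 , _))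
    (λ inj → injective⇒no-collision λ c₁ c₂ s₁ s₂ _ → inj c₁ c₂ s₁ s₂)
    where open Collisions F {λ _ → ⊤} (λ _ → yes tt)

  preInjective? : Decision (PreInjective F)
  preInjective? = decision-by (¬? collision?) λ _ → mk⇔
    (λ none c₁ c₂ s₁ s₂ → no-collision⇒injective none c₁ c₂ s₁ s₂ ∘ differFinitely⇒bounded)
    (λ inj → injective⇒no-collision λ c₁ c₂ s₁ s₂ → inj c₁ c₂ s₁ s₂ ∘ bounded⇒differFinitely)
    where open Collisions F (uncurry Fin._≟_)

module Forcing {q : ℕ} (F : SCA q) where
  open SCA F using (f; ρ′; V; V′; V′-unique)

  -- Whatever the random symbols are, cell 0 gets the state b.  The hypothesis
  -- Fin (r F) makes this hold vacuously if there are no random configurations,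
  -- even for an automaton that does not read any random symbol.
  Forces : Fin q → Pred (Config q) 0ℓ
  Forces b c = Fin (r F) → ∀ (w : Vec (Fin (r F)) ρ′) → f (Vec.map c V) w ≡ b

  forces? : ∀ b → U.Decidable (Forces b)
  forces? b c = inhabited? (Fin-finite (r F)) →-dec
                every? (Vec-finite (Fin-finite (r F)) ρ′) λ w → f (Vec.map c V) w Fin.≟ b

  forces-local : ∀ b → Local (bound V) (Forces b)
  forces-local b agree forced y w =
    trans (cong (λ vs → f vs w) (sym (map-local V agree))) (forced y w)

  open Language (Fin-finite q) (bound V) {q} {Forces} forces? forces-local

  forces⇒⊆ : ∀ c u → (∀ i → Forces (lookup u i) (shift (+ toℕ i) c)) → 𝒩 F c ⊆ [ u ]₀
  forces⇒⊆ c u forced (s , eq) i = trans (sym (eq (+ toℕ i))) (forced i (s 0ℤ) _)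

  -- A random configuration realising the symbols w around cell i exists because
  -- the entries of V′ are distinct.
  ⊆⇒forces : ∀ c u → 𝒩 F c ⊆ [ u ]₀ → ∀ i → Forces (lookup u i) (shift (+ toℕ i) c)
  ⊆⇒forces c u incl i y w = trans (cong (f _) (sym s-reads-w)) (incl (s , λ _ → refl) i)
    where
    s : Config (r F)
    s z = assign V′ w y (z - + toℕ i)
    s-reads-w : Vec.map (λ v → s (+ toℕ i + v)) V′ ≡ w
    s-reads-w = trans
      (map-cong (λ v → cong (assign V′ w y)
        (trans (cong (_- + toℕ i) (ℤ.+-comm (+ toℕ i) v)) (i+j-j≡i v (+ toℕ i)))) V′)
      (map-assign V′-unique w y)

  forced? : ∀ {L} → Rational L →
            Decision (∃[ u ] u ∈ L × Σ[ c ∈ Config q ] 𝒩 F c ⊆ [ u ]₀)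
  forced? (e , L⊆e , e⊆L) = decision-by (produces? e) λ _ → mk⇔
    (λ (u , m , c , forced) → u , e⊆L m , c , λ {d} → forces⇒⊆ c u forced {d})
    (λ (u , u∈L , c , incl) → u , L⊆e u∈L , c , ⊆⇒forces c u (λ {d} → incl {d}))

module Possibility {q : ℕ} (F : SCA q) where

  -- The random symbols are part of the letters, and cell 0 gets the state b.
  Allows : Fin q → Pred (ℤ → Fin q × Fin (r F)) 0ℓ
  Allows b x = rule F (proj₁ ∘ x) (proj₂ ∘ x) ≡ b

  allows-local : ∀ b → Local (radius F) (Allows b)
  allows-local b agree = trans (sym (rule-local F
    (λ v le → cong proj₁ (agree v le)) (λ v le → cong proj₂ (agree v le))))

  open Language (Fin-finite q ×-finite Fin-finite (r F)) (radius F)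
    {q} {Allows} (λ b x → _ Fin.≟ b) allows-local

  possible? : ∀ {L} → Rational L →
              Decision (∃[ u ] u ∈ L × Σ[ c ∈ Config q ] Satisfiable (𝒩 F c ∩ [ u ]₀))
  possible? (e , L⊆e , e⊆L) = decision-by (produces? e) λ _ → mk⇔
    (λ (u , m , x , allowed) → u , e⊆L m , proj₁ ∘ x ,
      global F (proj₁ ∘ x) (proj₂ ∘ x) , (proj₂ ∘ x , λ _ → refl) , allowed)
    (λ (u , u∈L , c , d , (s , eq) , d∈u) →
      u , L⊆e u∈L , (λ z → c z , s z) , λ i → trans (eq (+ toℕ i)) (d∈u i))

corollary6p8 : Decidable {A = Σ ℕ SCA} (λ (q , F) → Noisy F)
    × Decidable {A = Σ ℕ SCA} (λ (q , F) → Surjective F)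
    × Decidable {A = Σ ℕ SCA} (λ (q , F) → Injective F)
    × Decidable {A = Σ ℕ SCA} (λ (q , F) → PreInjective F)
    × ((t : ℕ) .{{_ : NonZero t}} →
    Decidable {A = Σ[ q ∈ ℕ ] SCA q × SCA q} (λ (q , F , G) →
    ∀ (c : Config q) → 𝒩^ t F c ≐ 𝒩^ t G c))
    × ((q : ℕ) (L : Pred (List (Fin q)) 0ℓ) → Rational L →
    Decidable {A = SCA q} (λ F →
    ∃[ u ] u ∈ L × Σ[ c ∈ Config q ] 𝒩 F c ⊆ [ u ]₀))
    × ((q : ℕ) (L : Pred (List (Fin q)) 0ℓ) → Rational L →
    Decidable {A = SCA q} (λ F →
    ∃[ u ] u ∈ L × Σ[ c ∈ Config q ] Satisfiable (𝒩 F c ∩ [ u ]₀)))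
corollary6p8 =
  decidable (λ (q , F) → Noise.noisy? F) ,
  decidable (λ (q , F) → Surjection.surjective? F) ,
  decidable (λ (q , F) → injective? F) ,
  decidable (λ (q , F) → preInjective? F) ,
  (λ t → decidable λ (q , F , G) → equality? t F G) ,
  (λ q L rational → decidable λ F → Forcing.forced? F rational) ,
  (λ q L rational → decidable λ F → Possibility.possible? F rational)
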